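{- Let $w$ be a Dyck path that can be written as $w=(u,1,v,1,0,0,0^k)$ where $v$ is a Dyck path, $u$ is a word and $k\geq 0$. Let $u'=(u,1,0,0^k)$, which is a Dyck path. Then the principal upper ideal $\operatorname{Up}(w)$ is isomorphic as a poset to the product of $\operatorname{Up}(u')$ and $\operatorname{Up}(v)$.
   Context: A Dyck path of size $n\geq 0$ is a word of length $2n$ in the letters $0,1$ with $n$ letters $1$ and $n$ letters $0$ such that every prefix contains at least as many $1$'s as $0$'s (the height after a prefix is its number of $1$'s minus its number of $0$'s). Let $\mathscr{D}_n$ be the set of Dyck paths of size $n$. A subpath of a Dyck path $w$ is a non-empty sequence $x$ of consecutive letters of $w$ that starts and ends at the same height and stays strictly above that height in between. A subpath $x$ is movable in $w$ if it is immediately preceded in $w$ by the letter $0$ and either $x$ ends at the last letter of $w$ or $x$ is immediately followed in $w$ by the letter $1$. For a movable subpath $x$, let $N=N(w,x)\geq 1$ be the number of consecutive letters $0$ just before $x$, so $w=a\,0^{N}\,x\,b$ where $a$ does not end with $0$; for $1\leq i\leq N$ let $M(w,x,i)=a\,0^{N-i}\,x\,0^{i}\,b\in\mathscr{D}_n$. Let $\Gamma_n$ be the directed graph on $\mathscr{D}_n$ with edges $w\to M(w,x,i)$ for all movable $x$ in $w$ and all $1\leq i\leq N(w,x)$. The dexter order is: $u\leq v$ if and only if there is a directed path (possibly of length $0$) from $u$ to $v$ in $\Gamma_n$. This is a partial order whose cover relations are exactly the edges of $\Gamma_n$. For a Dyck path $w\in\mathscr{D}_n$, $\operatorname{Up}(w)=\{z\in\mathscr{D}_n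 : w\leq z\}$ with the induced order. Products of posets carry the componentwise order. -}

module Defs where

open import Data.Empty using (⊥-elim)
open import Data.Fin using (Fin)
import Data.Fin as Fin
open import Data.Fin.Patterns using (0F; 1F)
import Data.Fin.Properties as Fin
open import Data.Integer as ℤ using (ℤ; _⊖_)
import Data.Integer.Properties as ℤ
open import Data.List using (List; []; _∷_; _++_; _∷ʳ_; length; filter; replicate)
open import Data.List.Properties using (filter-++; length-++)
open import Data.List.Relation.Binary.Lex.Strict using (Lex-<; this; next; <-irreflexive; <-transitive)
import Data.List.Relation.Binary.Pointwise as Pointwise
open import Data.Nat using (ℕ; zero; suc; _+_; _∸_; _≤_; s≤s; z≤n)
import Data.Nat.Properties as ℕ
open import Data.Product using (∃; _,_; proj₁)
open import Data.Sum using (_⊎_; inj₁; inj₂)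
open import Level using (0ℓ)
open import Relation.Binary using (Rel; Poset)
import Relation.Binary.Construct.On as On
open import Relation.Binary.Construct.Closure.ReflexiveTransitive using (Star; ε; _◅_; _◅◅_)
open import Relation.Binary.Morphism.Structures using (IsOrderIsomorphism)
open import Relation.Binary.PropositionalEquality
open import Relation.Nullary using (¬_)

Letter : Set
Letter = Fin 2

Word : Set
Word = List Letter

# : Letter → Word → ℕ
# c p = length (filter (c Fin.≟_) p)

height : Word → ℤ
height p = # 1F p ⊖ # 0F p

record IsDyck (n : ℕ) (w : Word) : Set where
  field
    ones   : # 1F w ≡ n
    zeros  : # 0F w ≡ n
    prefix : ∀ p s → w ≡ p ++ s → # 0F p ≤ # 1F p

-- The proof is irrelevant, so _≡_ on Dyck paths is equality of words.
record DyckPath (n : ℕ) : Set where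
  constructor dyck
  field
    word    : Word
    .isDyck : IsDyck n word

open DyckPath public

-- A subpath is a particular occurrence of x: here the one in the word
-- p ++ x ++ s that comes directly after p. The definition does not involve s.
record IsSubpath (p x : Word) : Set where
  field
    nonempty    : ¬ (x ≡ [])
    sameHeight  : height (p ++ x) ≡ height p
    staysAbove  : ∀ y z → x ≡ y ++ z → ¬ (y ≡ []) → ¬ (z ≡ []) →
                  height p ℤ.< height (p ++ y)

StartsWith : Letter → Word → Set
StartsWith c s = ∃ λ t → s ≡ c ∷ t

EndsWith : Letter → Word → Set
EndsWith c p = ∃ λ t → p ≡ t ∷ʳ c

-- x is movable in p ++ x ++ s, at the occurrence directly after p.
record IsMovable (p x s : Word) : Set where
  field
    isSubpath  : IsSubpath p x
    precededBy : EndsWith 0F p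
    followedBy : (s ≡ []) ⊎ StartsWith 1F s

-- An edge w → M(w, x, i) of Γₙ. Since M(w, x, i) is again a Dyck path of size n,
-- taking w′ in DyckPath n loses no edges.
record _⟶_ {n : ℕ} (w w′ : DyckPath n) : Set where
  field
    a x b   : Word
    N i     : ℕ
    source  : word w ≡ a ++ replicate N 0F ++ x ++ b
    maximal : ¬ EndsWith 0F a
    movable : IsMovable (a ++ replicate N 0F) x b
    1≤i     : 1 ≤ i
    i≤N     : i ≤ N
    target  : word w′ ≡ a ++ replicate (N ∸ i) 0F ++ x ++ replicate i 0F ++ b

_≼_ : ∀ {n} → Rel (DyckPath n) 0ℓ
_≼_ = Star _⟶_

-- Antisymmetry: along each edge the word increases lexicographically.

private
  _<ₗ_ : Rel Word 0ℓ
  _<ₗ_ = Lex-< _≡_ Fin._<_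

  <ₗ-trans : ∀ {u v w} → u <ₗ v → v <ₗ w → u <ₗ w
  <ₗ-trans = <-transitive isEquivalence (resp₂ Fin._<_) Fin.<-trans

  <ₗ-irrefl : ∀ {w} → ¬ (w <ₗ w)
  <ₗ-irrefl = <-irreflexive Fin.<-irrefl (Pointwise.refl refl)

  ++-<ₗ : ∀ p {u v} → u <ₗ v → (p ++ u) <ₗ (p ++ v)
  ++-<ₗ []      u<v = u<v
  ++-<ₗ (c ∷ p) u<v = next refl (++-<ₗ p u<v)

  #-++ : ∀ c p q → # c (p ++ q) ≡ # c p + # c q
  #-++ c p q = trans (cong length (filter-++ (c Fin.≟_) p q))
                     (length-++ (filter (c Fin.≟_) p))

  height-∷ʳ0 : ∀ p → height (p ∷ʳ 0F) ℤ.< height p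
  height-∷ʳ0 p
    rewrite #-++ 1F p (0F ∷ []) | #-++ 0F p (0F ∷ [])
          | ℕ.+-identityʳ (# 1F p)
    = ℤ.⊖-monoʳ->-< (# 1F p) (ℕ.m<m+n (# 0F p) (s≤s z≤n))

  subpath-starts-1 : ∀ {p x} → IsSubpath p x → StartsWith 1F x
  subpath-starts-1 {p} {[]}         S = ⊥-elim (IsSubpath.nonempty S refl)
  subpath-starts-1 {p} {0F ∷ []}    S =
    ⊥-elim (ℤ.<-irrefl (IsSubpath.sameHeight S) (height-∷ʳ0 p))
  subpath-starts-1 {p} {0F ∷ c ∷ x} S =
    ⊥-elim (ℤ.<-asym (IsSubpath.staysAbove S (0F ∷ []) (c ∷ x) refl (λ ()) (λ ()))
                     (height-∷ʳ0 p))
  subpath-starts-1 {p} {1F ∷ x}     S = x , refl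

  zeros-<ₗ : ∀ {N i} x y z → 1 ≤ i → i ≤ N →
             (replicate N 0F ++ x) <ₗ (replicate (N ∸ i) 0F ++ (1F ∷ y) ++ z)
  zeros-<ₗ {suc N} {suc i} x y z 1≤i (s≤s i≤N) = go N (N ∸ i) (ℕ.m∸n≤m N i)
    where
    go : ∀ k j → j ≤ k → (replicate (suc k) 0F ++ x) <ₗ (replicate j 0F ++ 1F ∷ y ++ z)
    go k       zero    _         = this (s≤s z≤n)
    go (suc k) (suc j) (s≤s j≤k) = next refl (go k j j≤k)

  ⟶⇒<ₗ : ∀ {n} {w w′ : DyckPath n} → w ⟶ w′ → word w <ₗ word w′
  ⟶⇒<ₗ e with subpath-starts-1 (IsMovable.isSubpath (_⟶_.movable e))
  ... | y , refl = subst₂ _<ₗ_ (sym source) (sym target)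
                     (++-<ₗ a (zeros-<ₗ (x ++ b) y (replicate i 0F ++ b) 1≤i i≤N))
    where open _⟶_ e

  ≼⇒≡⊎<ₗ : ∀ {n} {w w′ : DyckPath n} → w ≼ w′ → (w ≡ w′) ⊎ (word w <ₗ word w′)
  ≼⇒≡⊎<ₗ ε       = inj₁ refl
  ≼⇒≡⊎<ₗ (e ◅ p) with ≼⇒≡⊎<ₗ p
  ... | inj₁ refl = inj₂ (⟶⇒<ₗ e)
  ... | inj₂ lt   = inj₂ (<ₗ-trans (⟶⇒<ₗ e) lt)

≼-antisym : ∀ {n} {w w′ : DyckPath n} → w ≼ w′ → w′ ≼ w → w ≡ w′
≼-antisym p q with ≼⇒≡⊎<ₗ p | ≼⇒≡⊎<ₗ q
... | inj₁ eq | _       = eq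
... | inj₂ _  | inj₁ eq = sym eq
... | inj₂ lt | inj₂ gt = ⊥-elim (<ₗ-irrefl (<ₗ-trans lt gt))

dexter : ℕ → Poset 0ℓ 0ℓ 0ℓ
dexter n = record
  { Carrier        = DyckPath n
  ; _≈_            = _≡_
  ; _≤_            = _≼_
  ; isPartialOrder = record
    { isPreorder = record
      { isEquivalence = isEquivalence
      ; reflexive     = λ { refl → ε }
      ; trans         = _◅◅_
      }
    ; antisym = ≼-antisym
    }
  }

-- Elements are compared through the underlying Dyck path z only, so different
-- chains witnessing w ≼ z give equal elements.
Up : ∀ {n} → DyckPath n → Poset 0ℓ 0ℓ 0ℓ
Up {n} w = On.poset (dexter n) (proj₁ {A = DyckPath n} {B = w ≼_})

_≅_ : Poset 0ℓ 0ℓ 0ℓ → Poset 0ℓ 0ℓ 0ℓ → Set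
P ≅ Q = ∃ λ f → IsOrderIsomorphism P._≈_ Q._≈_ P._≤_ Q._≤_ f
  where
  module P = Poset P
  module Q = Poset Q

{-# OPTIONS --safe #-}

-- Up(w) consists of the paths p 1 v′ 1 0 0 0ʲ with p 1 0 0ʲ in Up(u′) and v′ in Up(v).
-- Indeed, let x be a movable subpath of p 1 v 1 0 0 0ᵏ. If x starts after p 1, it cannot
-- be the last 1 0, which is followed by 0, so it lies in v and is movable there. Otherwise
-- x ends before the block 1 v 1 0 0 or extends to the end of the path; moving it keeps
-- the block intact, and does so for any block 1 D 0 with D a Dyck path. Hence
-- the edges from p 1 v 1 0 0 0ᵏ are the edges from p 1 0 0ᵏ together with those from v.
-- As the two factors are determined by the path, this gives the isomorphism.
module Submission where

open import Defs
open import Data.Fin.Patterns using (0F; 1F)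
open import Data.List using (_++_; _∷_; replicate)
open import Data.Nat using (ℕ)
open import Data.Product using (_×_; ∃₂)
open import Data.Product.Relation.Binary.Pointwise.NonDependent using (×-poset)
open import Relation.Binary.PropositionalEquality using (_≡_)

import Data.Fin as Fin
open import Data.Integer as ℤ using (_⊖_; 0ℤ)
import Data.Integer.Properties as ℤ
import Data.Integer.Tactic.RingSolver as ℤ-Solver
open import Data.List using ([]; _∷ʳ_; filter; length)
open import Data.List.Properties using (++-assoc; ++-identityʳ; filter-++; length-++; length-replicate;
  ∷-injective)
open import Data.Nat using (zero; suc; _+_; _∸_; _≤_; _<_; z≤n; s≤s)
open import Data.Nat.Properties as ℕ using (≤-refl; ≤-trans)
open import Data.Product using (∃; _,_; proj₁; proj₂)
open import Data.Sum using (_⊎_; inj₁; inj₂)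
open import Relation.Binary using (Poset)
open import Relation.Binary.Construct.Closure.ReflexiveTransitive using (ε; _◅_; _◅◅_)
open import Relation.Binary.PropositionalEquality using (_≢_; refl; sym; trans; cong;
  subst; subst₂; module ≡-Reasoning)
open import Relation.Nullary using (¬_; Dec; yes; no; contradiction)
open import Relation.Nullary.Decidable using (recompute; map′; _×-dec_)

open import Algebra.Properties.CommutativeSemigroup ℕ.+-commutativeSemigroup using (x∙yz≈y∙xz)
open import Algebra.Properties.AbelianGroup ℤ.+-0-abelianGroup using (identityʳ-unique)

-- Runs of zeros and splittings of words

zeros : ℕ → Word
zeros k = replicate k 0F

zeros-+ : ∀ m {n} → zeros (m + n) ≡ zeros m ++ zeros n
zeros-+ zero    = refl
zeros-+ (suc m) = cong (0F ∷_) (zeros-+ m)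

zeros-∷ʳ : ∀ n → zeros (suc n) ≡ zeros n ∷ʳ 0F
zeros-∷ʳ zero    = refl
zeros-∷ʳ (suc n) = cong (0F ∷_) (zeros-∷ʳ n)

zeros-no-1 : ∀ k c {s} → zeros k ≢ c ++ 1F ∷ s
zeros-no-1 (suc k) (0F ∷ c) eq = zeros-no-1 k c (proj₂ (∷-injective eq))
zeros-no-1 (suc k) []       ()
zeros-no-1 zero    (_ ∷ _)  ()
zeros-no-1 (suc k) (1F ∷ c) ()

-- Levi's lemma with a marked letter `d`; it locates a fixed letter 1 of a path relative to the
-- pieces of a move.
split-at : ∀ xs {ys} us {d : Letter} {vs} → xs ++ ys ≡ us ++ d ∷ vs →
           (∃ λ c → us ≡ xs ++ c × ys ≡ c ++ d ∷ vs) ⊎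
           (∃ λ c → xs ≡ us ++ d ∷ c × vs ≡ c ++ ys)
split-at []       us       eq = inj₁ (us , refl , eq)
split-at (x ∷ xs) []       eq with refl , eq′ ← ∷-injective eq = inj₂ (xs , refl , sym eq′)
split-at (x ∷ xs) (u ∷ us) eq with refl , eq′ ← ∷-injective eq with split-at xs us eq′
... | inj₁ (c , p , q) = inj₁ (c , cong (x ∷_) p , q)
... | inj₂ (c , p , q) = inj₂ (c , cong (x ∷_) p , q)

-- If one prefix were longer, the tail of the other side would contain `d` followed by its own tail,
-- which the two hypotheses exclude.
split-unique : ∀ p p′ {d : Letter} {v v′} → (∀ c → v ≢ c ++ d ∷ v′) → (∀ c → v′ ≢ c ++ d ∷ v) →
               p ++ d ∷ v ≡ p′ ++ d ∷ v′ → p ≡ p′ × v ≡ v′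
split-unique []      []       _ _ eq = refl , proj₂ (∷-injective eq)
split-unique []      (_ ∷ p′) f _ eq = contradiction (proj₂ (∷-injective eq)) (f p′)
split-unique (_ ∷ p) []       _ g eq = contradiction (sym (proj₂ (∷-injective eq))) (g p)
split-unique (_ ∷ p) (_ ∷ p′) f g eq
  with refl , eq′ ← ∷-injective eq
  with refl , refl ← split-unique p p′ f g eq′ = refl , refl

-- Restores the maximal run of zeros that `_⟶_` demands and `Move` leaves out.
trim-zeros : ∀ a → ∃₂ λ a₀ n → a ≡ a₀ ++ zeros n × ¬ EndsWith 0F a₀
trim-zeros [] = [] , 0 , refl , λ { ([] , ()) ; (_ ∷ _ , ()) }
trim-zeros (c ∷ a) with trim-zeros a
trim-zeros (0F ∷ a) | [] , n , refl , ne = [] , suc n , refl , ne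
trim-zeros (1F ∷ a) | [] , n , refl , _  =
  1F ∷ [] , n , refl , λ { ([] , ()) ; (_ ∷ [] , ()) ; (_ ∷ _ ∷ _ , ()) }
trim-zeros (c ∷ a)  | d ∷ a₀ , n , refl , ne =
  c ∷ d ∷ a₀ , n , refl , λ { ([] , ()) ; (_ ∷ t , eq) → ne (t , proj₂ (∷-injective eq)) }

-- Descending paths

-- Desc b h w: the path w descends from height h to height 0, and its height is at
-- least b except possibly at the end. Dyck paths are the case b = h = 0, and a
-- subpath is a letter 1 followed by a word with b = h = 1.
data Desc (b : ℕ) : ℕ → Word → Set where
  nil  : Desc b 0 []
  up   : ∀ {h w} → b ≤ h → Desc b (suc h) w → Desc b h (1F ∷ w)
  down : ∀ {h w} → b ≤ suc h → Desc b h w → Desc b (suc h) (0F ∷ w)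

-- The field `isDyck` is irrelevant; decidability lets `word-desc` recompute a usable `Desc` from
-- it.
desc? : ∀ b h w → Dec (Desc b h w)
desc? b zero    []       = yes nil
desc? b (suc h) []       = no λ ()
desc? b zero    (0F ∷ w) = no λ ()
desc? b (suc h) (0F ∷ w) = map′ (λ (p , q) → down p q) (λ { (down p q) → p , q })
                                (b ℕ.≤? suc h ×-dec desc? b h w)
desc? b h       (1F ∷ w) = map′ (λ (p , q) → up p q) (λ { (up p q) → p , q })
                                (b ℕ.≤? h ×-dec desc? b (suc h) w)

desc-weaken : ∀ {b b′ h w} → b′ ≤ b → Desc b h w → Desc b′ h w
desc-weaken le nil        = nil
desc-weaken le (up p d)   = up (≤-trans le p) (desc-weaken le d)
desc-weaken le (down p d) = down (≤-trans le p) (desc-weaken le d)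

desc-start-unique : ∀ {b b′ h h′ w} → Desc b h w → Desc b′ h′ w → h ≡ h′
desc-start-unique nil        nil         = refl
desc-start-unique (up _ d)   (up _ d′)   = ℕ.suc-injective (desc-start-unique d d′)
desc-start-unique (down _ d) (down _ d′) = cong suc (desc-start-unique d d′)

desc-suffix : ∀ {b h} p {s} → Desc b h (p ++ s) → ∃ λ h′ → Desc b h′ s
desc-suffix []      d          = _ , d
desc-suffix (_ ∷ p) (up _ d)   = desc-suffix p d
desc-suffix (_ ∷ p) (down _ d) = desc-suffix p d

desc-remove : ∀ {b g h d s} → Desc 0 g d → Desc b (g + h) (d ++ s) → Desc b h s
desc-remove nil        q          = q
desc-remove (up _ d)   (up _ q)   = desc-remove d q
desc-remove (down _ d) (down _ q) = desc-remove d q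

-- The inserted piece stays at height `h` or more, so `b ≤ h` preserves the lower bound.
desc-insert : ∀ {b g h d s} → b ≤ h → Desc 0 g d → Desc b h s → Desc b (g + h) (d ++ s)
desc-insert b≤h nil        q = q
desc-insert b≤h (up {h = g} _ d) q = up (≤-trans b≤h (ℕ.m≤n+m _ g)) (desc-insert b≤h d q)
desc-insert b≤h (down {h = g} _ d) q = down (≤-trans b≤h (ℕ.m≤n+m _ (suc g))) (desc-insert b≤h d q)

-- Both pieces return to the height where they start, so the rest is unaffected. The letter 1 in
-- front lifts them to `suc h` with `b ≤ h`, so the bound survives.
desc-swap : ∀ {b h D D′} → Desc 0 0 D → Desc 0 0 D′ → ∀ c {s} →
            Desc b h (c ++ 1F ∷ D ++ s) → Desc b h (c ++ 1F ∷ D′ ++ s)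
desc-swap dD dD′ [] (up p q) = up p (desc-insert (ℕ.m≤n⇒m≤1+n p) dD′ (desc-remove dD q))
desc-swap dD dD′ (_ ∷ c) (up p q)   = up p (desc-swap dD dD′ c q)
desc-swap dD dD′ (_ ∷ c) (down p q) = down p (desc-swap dD dD′ c q)

-- The prime Dyck paths; unlike `IsSubpath`, the notion is free of the preceding word.
data Prime : Word → Set where
  prime : ∀ {r} → Desc 1 1 r → Prime (1F ∷ r)

prime⇒desc : ∀ {x} → Prime x → Desc 0 0 x
prime⇒desc (prime d) = up z≤n (desc-weaken z≤n d)

prime-swap : ∀ {D D′} → Desc 0 0 D → Desc 0 0 D′ → ∀ c {s} →
             Prime (c ++ 1F ∷ D ++ s) → Prime (c ++ 1F ∷ D′ ++ s)
prime-swap dD dD′ []      (prime q) = prime (desc-insert ≤-refl dD′ (desc-remove dD q))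
prime-swap dD dD′ (_ ∷ c) (prime q) = prime (desc-swap dD dD′ c q)

-- Letter counts and Dyck paths

#-++ : ∀ c p q → # c (p ++ q) ≡ # c p + # c q
#-++ c p q = trans (cong length (filter-++ (c Fin.≟_) p q)) (length-++ (filter (c Fin.≟_) p))

desc⇒balanced : ∀ {b h w} → Desc b h w → h + # 1F w ≡ # 0F w
desc⇒balanced nil = refl
desc⇒balanced (up {h = h} {w} _ d) = trans (ℕ.+-suc h (# 1F w)) (desc⇒balanced d)
desc⇒balanced (down _ d) = cong suc (desc⇒balanced d)

-- The letter `c` shows that `y` stops before the end of the path, the only place where the bound
-- may fail.
desc⇒above : ∀ {b h} y {c z} → Desc b h (y ++ c ∷ z) → b + # 0F y ≤ h + # 1F y
desc⇒above {b} {h} [] {0F} (down p d) = ℕ.+-monoˡ-≤ 0 p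
desc⇒above [] {1F} (up p d) = ℕ.+-monoˡ-≤ 0 p
desc⇒above {b} {h} (1F ∷ y) (up p d) =
  subst (b + # 0F y ≤_) (sym (ℕ.+-suc h (# 1F y))) (desc⇒above y d)
desc⇒above {b} {suc h} (0F ∷ y) (down p d) =
  subst (_≤ suc h + # 1F y) (sym (ℕ.+-suc b (# 0F y))) (s≤s (desc⇒above y d))

counts⇒desc : ∀ {b} h w → h + # 1F w ≡ # 0F w →
              (∀ y c z → w ≡ y ++ c ∷ z → b + # 0F y ≤ h + # 1F y) → Desc b h w
counts⇒desc zero    []       bal above = nil
counts⇒desc (suc h) []       () above
counts⇒desc {b} h (1F ∷ w) bal above =
  up (subst₂ _≤_ (ℕ.+-identityʳ _) (ℕ.+-identityʳ _) (above [] 1F w refl))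
     (counts⇒desc (suc h) w (trans (sym (ℕ.+-suc h _)) bal)
       (λ y c z eq → subst (b + # 0F y ≤_) (ℕ.+-suc h (# 1F y))
                       (above (1F ∷ y) c z (cong (1F ∷_) eq))))
counts⇒desc zero (0F ∷ []) () above
-- The letter 0 leads below height 0 while a letter is still to come, which violates the bound.
counts⇒desc {b} zero (0F ∷ c ∷ w) bal above =
  contradiction (subst (_≤ 0) (ℕ.+-suc b 0) (above (0F ∷ []) c w refl)) λ ()
counts⇒desc {b} (suc h) (0F ∷ w) bal above =
  down (subst₂ _≤_ (ℕ.+-identityʳ _) (ℕ.+-identityʳ _) (above [] 0F w refl))
       (counts⇒desc h w (ℕ.suc-injective bal)
         (λ y c z eq → ℕ.≤-pred (subst (_≤ suc h + # 1F y) (ℕ.+-suc b (# 0F y))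
                         (above (0F ∷ y) c z (cong (0F ∷_) eq)))))

isDyck⇒desc : ∀ {n w} → IsDyck n w → Desc 0 0 w
isDyck⇒desc D = counts⇒desc 0 _ (trans ones (sym zeros')) (λ y c z → prefix y (c ∷ z))
  where open IsDyck D renaming (zeros to zeros')

desc⇒isDyck : ∀ {n w} → # 1F w ≡ n → Desc 0 0 w → IsDyck n w
desc⇒isDyck {n} {w} eq d = record
  { ones   = eq
  ; zeros  = trans (sym (desc⇒balanced d)) eq
  ; prefix = above
  }
  where
  above : ∀ p s → w ≡ p ++ s → # 0F p ≤ # 1F p
  above p []      refl rewrite ++-identityʳ p = ℕ.≤-reflexive (sym (desc⇒balanced d))
  above p (_ ∷ _) refl = desc⇒above p d

word-desc : ∀ {n} (w : DyckPath n) → Desc 0 0 (word w)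
word-desc (dyck w D) = recompute (desc? 0 0 w) (isDyck⇒desc D)

-- Heights and subpaths

height-++ : ∀ p q → height (p ++ q) ≡ height p ℤ.+ height q
height-++ p q
  rewrite #-++ 1F p q | #-++ 0F p q
        | sym (ℤ.m-n≡m⊖n (# 1F p + # 1F q) (# 0F p + # 0F q))
        | sym (ℤ.m-n≡m⊖n (# 1F p) (# 0F p))
        | sym (ℤ.m-n≡m⊖n (# 1F q) (# 0F q))
        | ℤ.pos-+ (# 1F p) (# 1F q)
        | ℤ.pos-+ (# 0F p) (# 0F q)
  = lemma (ℤ.+ # 1F p) (ℤ.+ # 1F q) (ℤ.+ # 0F p) (ℤ.+ # 0F q)
  where
  lemma : ∀ a b c d → (a ℤ.+ b) ℤ.- (c ℤ.+ d) ≡ (a ℤ.- c) ℤ.+ (b ℤ.- d)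
  lemma = ℤ-Solver.solve-∀

subpath-balanced : ∀ p {x} → height (p ++ x) ≡ height p → # 1F x ≡ # 0F x
subpath-balanced p {x} eq = ℤ.+-injective (ℤ.i-j≡0⇒i≡j (ℤ.+ # 1F x) (ℤ.+ # 0F x)
  (trans (ℤ.m-n≡m⊖n (# 1F x) (# 0F x))
         (identityʳ-unique (height p) (height x) (trans (sym (height-++ p x)) eq))))

height-<⇒counts : ∀ p {y} → height p ℤ.< height (p ++ y) → # 0F y < # 1F y
height-<⇒counts p {y} lt = ℕ.≰⇒> λ le → ℤ.<⇒≱ lt (begin
  height (p ++ y)          ≡⟨ height-++ p y ⟩
  height p ℤ.+ height y    ≤⟨ ℤ.+-monoʳ-≤ (height p) (ℤ.⊖-monoˡ-≤ (# 0F y) le) ⟩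
  height p ℤ.+ (# 0F y ⊖ # 0F y) ≡⟨ cong (λ t → height p ℤ.+ t) (ℤ.n⊖n≡0 (# 0F y)) ⟩
  height p ℤ.+ 0ℤ          ≡⟨ ℤ.+-identityʳ (height p) ⟩
  height p                 ∎)
  where open ℤ.≤-Reasoning

counts⇒height-< : ∀ p {y} → # 0F y < # 1F y → height p ℤ.< height (p ++ y)
counts⇒height-< p {y} lt = begin-strict
  height p                 ≡⟨ ℤ.+-identityʳ (height p) ⟨
  height p ℤ.+ 0ℤ          ≡⟨ cong (λ t → height p ℤ.+ t) (ℤ.n⊖n≡0 (# 0F y)) ⟨
  height p ℤ.+ (# 0F y ⊖ # 0F y) <⟨ ℤ.+-monoʳ-< (height p) (ℤ.⊖-monoˡ-< (# 0F y) lt) ⟩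
  height p ℤ.+ height y    ≡⟨ height-++ p y ⟨
  height (p ++ y)          ∎
  where open ℤ.≤-Reasoning

subpath⇒prime : ∀ {p} x → IsSubpath p x → Prime x
subpath⇒prime {p} x S = go x refl
  where
  open IsSubpath S
  bal : # 1F x ≡ # 0F x
  bal = subpath-balanced p sameHeight
  above : ∀ y z → x ≡ y ++ z → ¬ (y ≡ []) → ¬ (z ≡ []) → # 0F y < # 1F y
  above y z eq ¬y ¬z = height-<⇒counts p (staysAbove y z eq ¬y ¬z)
  go : ∀ r → x ≡ r → Prime r
  go []           eq = contradiction eq nonempty
  go (0F ∷ [])    refl = contradiction bal λ ()
  go (0F ∷ c ∷ r) eq = contradiction (above (0F ∷ []) (c ∷ r) eq (λ ()) (λ ())) λ ()
  go (1F ∷ r)     eq = prime (counts⇒desc 1 r (subst (λ t → # 1F t ≡ # 0F t) eq bal)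
    λ y c z eq′ → above (1F ∷ y) (c ∷ z) (trans eq (cong (1F ∷_) eq′)) (λ ()) (λ ()))

prime⇒subpath : ∀ p {x} → Prime x → IsSubpath p x
prime⇒subpath p {1F ∷ r} (prime d) = record
  { nonempty   = λ ()
  ; sameHeight = begin
      height (p ++ 1F ∷ r)         ≡⟨ height-++ p (1F ∷ r) ⟩
      height p ℤ.+ (suc (# 1F r) ⊖ # 0F r) ≡⟨ cong (λ t → height p ℤ.+ (t ⊖ # 0F r)) (desc⇒balanced d) ⟩
      height p ℤ.+ (# 0F r ⊖ # 0F r) ≡⟨ cong (λ t → height p ℤ.+ t) (ℤ.n⊖n≡0 (# 0F r)) ⟩
      height p ℤ.+ 0ℤ              ≡⟨ ℤ.+-identityʳ (height p) ⟩
      height p                     ∎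
  ; staysAbove = λ y z eq ¬y ¬z → counts⇒height-< p (above y z eq ¬y ¬z)
  }
  where
  open ≡-Reasoning
  above : ∀ y z → 1F ∷ r ≡ y ++ z → ¬ (y ≡ []) → ¬ (z ≡ []) → # 0F y < # 1F y
  above []      z       eq   ¬y ¬z = contradiction refl ¬y
  above (_ ∷ y) []      eq   ¬y ¬z = contradiction refl ¬z
  above (1F ∷ y) (_ ∷ _) refl ¬y ¬z = desc⇒above y d

-- Edges as moves

-- An edge without the maximality of the block of zeros: the zeros of that block that
-- x does not jump over are absorbed in a.
record Move (w w′ : Word) : Set where
  constructor move
  field
    a        : Word
    i        : ℕ
    {x}      : Word
    b        : Word
    isPrime  : Prime x
    followed : (b ≡ []) ⊎ StartsWith 1F b
    source   : w ≡ a ++ zeros (suc i) ++ x ++ b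
    target   : w′ ≡ a ++ x ++ zeros (suc i) ++ b

edge⇒move : ∀ {n} {w w′ : DyckPath n} → w ⟶ w′ → Move (word w) (word w′)
edge⇒move record { i = zero ; 1≤i = () }
edge⇒move record { a = a ; x = x ; b = b ; N = N ; i = suc i ; source = source
                 ; movable = movable ; i≤N = i≤N ; target = target } =
  move (a ++ zeros (N ∸ suc i)) i b (subpath⇒prime x isSubpath) followedBy
    (trans source (begin
      a ++ zeros N ++ x ++ b
        ≡⟨ cong (λ t → a ++ zeros t ++ x ++ b) (ℕ.m∸n+n≡m i≤N) ⟨
      a ++ zeros (N ∸ suc i + suc i) ++ x ++ b
        ≡⟨ cong (λ t → a ++ t ++ x ++ b) (zeros-+ (N ∸ suc i)) ⟩
      a ++ (zeros (N ∸ suc i) ++ zeros (suc i)) ++ x ++ b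
        ≡⟨ cong (a ++_) (++-assoc (zeros (N ∸ suc i)) (zeros (suc i)) (x ++ b)) ⟩
      a ++ zeros (N ∸ suc i) ++ zeros (suc i) ++ x ++ b
        ≡⟨ ++-assoc a (zeros (N ∸ suc i)) _ ⟨
      (a ++ zeros (N ∸ suc i)) ++ zeros (suc i) ++ x ++ b ∎))
    (trans target (sym (++-assoc a (zeros (N ∸ suc i)) _)))
  where
  open IsMovable movable
  open ≡-Reasoning

move⇒edge : ∀ {n} {w w′ : DyckPath n} → Move (word w) (word w′) → w ⟶ w′
move⇒edge (move a i {x} b pr fol src tgt) with a₀ , n , refl , ne ← trim-zeros a = record
  { a = a₀ ; x = x ; b = b ; N = n + suc i ; i = suc i
  ; source  = trans src (begin
      (a₀ ++ zeros n) ++ zeros (suc i) ++ x ++ b ≡⟨ ++-assoc a₀ (zeros n) _ ⟩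
      a₀ ++ zeros n ++ zeros (suc i) ++ x ++ b   ≡⟨ cong (a₀ ++_) (++-assoc (zeros n) (zeros (suc i)) (x ++ b)) ⟨
      a₀ ++ (zeros n ++ zeros (suc i)) ++ x ++ b ≡⟨ cong (λ t → a₀ ++ t ++ x ++ b) (zeros-+ n) ⟨
      a₀ ++ zeros (n + suc i) ++ x ++ b          ∎)
  ; maximal = ne
  ; movable = record
    { isSubpath  = prime⇒subpath _ pr
    ; precededBy = a₀ ++ zeros (n + i) , (begin
        a₀ ++ zeros (n + suc i)        ≡⟨ cong (λ t → a₀ ++ zeros t) (ℕ.+-suc n i) ⟩
        a₀ ++ zeros (suc (n + i))      ≡⟨ cong (a₀ ++_) (zeros-∷ʳ (n + i)) ⟩
        a₀ ++ zeros (n + i) ∷ʳ 0F      ≡⟨ ++-assoc a₀ (zeros (n + i)) _ ⟨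
        (a₀ ++ zeros (n + i)) ∷ʳ 0F    ∎)
    ; followedBy = fol
    }
  ; 1≤i    = s≤s z≤n
  ; i≤N    = ℕ.m≤n+m (suc i) n
  ; target = trans tgt (begin
      (a₀ ++ zeros n) ++ x ++ zeros (suc i) ++ b ≡⟨ ++-assoc a₀ (zeros n) _ ⟩
      a₀ ++ zeros n ++ x ++ zeros (suc i) ++ b
        ≡⟨ cong (λ t → a₀ ++ zeros t ++ x ++ zeros (suc i) ++ b) (ℕ.m+n∸n≡m n (suc i)) ⟨
      a₀ ++ zeros (n + suc i ∸ suc i) ++ x ++ zeros (suc i) ++ b ∎)
  }
  where open ≡-Reasoning

-- Cutting out a balanced piece and pasting it elsewhere changes no other height, and the bound 0
-- allows pasting anywhere.
desc-move : ∀ {h} a i {x} b → Prime x →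
            Desc 0 h (a ++ zeros i ++ x ++ b) → Desc 0 h (a ++ x ++ zeros i ++ b)
desc-move []       i       b pr d          = desc-insert z≤n (prime⇒desc pr) (go i d)
  where
  go : ∀ {h} i → Desc 0 h (zeros i ++ _ ++ b) → Desc 0 h (zeros i ++ b)
  go zero    d          = desc-remove (prime⇒desc pr) d
  go (suc i) (down p d) = down p (go i d)
desc-move (_ ∷ a) i b pr (up p d)   = up p (desc-move a i b pr d)
desc-move (_ ∷ a) i b pr (down p d) = down p (desc-move a i b pr d)

#-move : ∀ c a s x {b} → # c (a ++ x ++ s ++ b) ≡ # c (a ++ s ++ x ++ b)
#-move c a s x {b}
  rewrite #-++ c a (x ++ s ++ b) | #-++ c x (s ++ b) | #-++ c s b
        | #-++ c a (s ++ x ++ b) | #-++ c s (x ++ b) | #-++ c x b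
  = cong (# c a +_) (x∙yz≈y∙xz (# c x) (# c s) (# c b))

move-isDyck : ∀ {n w w′} → Move w w′ → IsDyck n w → IsDyck n w′
move-isDyck (move a i {x} b pr _ refl refl) D = desc⇒isDyck
  (trans (#-move 1F a (zeros (suc i)) x) (IsDyck.ones D))
  (desc-move a (suc i) b pr (isDyck⇒desc D))

-- Since moves preserve Dyck paths and size, the target may be given as a bare word.
move-from : ∀ {n} (w : DyckPath n) {w′} → Move (word w) w′ → ∃ λ (z : DyckPath n) → word z ≡ w′ × w ≼ z
move-from (dyck w D) {w′} m = dyck w′ (move-isDyck m D) , refl , move⇒edge m ◅ ε

prime-not-in-zeros : ∀ {x} → Prime x → ∀ k c {b} → zeros k ≢ c ++ x ++ b
prime-not-in-zeros (prime _) k c = zeros-no-1 k c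

zeros-no-move : ∀ k {w′} → ¬ Move (zeros k) w′
zeros-no-move k (move a i _ pr _ src _) =
  prime-not-in-zeros pr k (a ++ zeros (suc i)) (trans src (sym (++-assoc a (zeros (suc i)) _)))

-- For movability, a following letter 1 is as good as the end of the word; this carries moves
-- between a factor and the whole path.
followed-++⁺ : ∀ {f} s → (f ≡ []) ⊎ StartsWith 1F f →
               (f ++ 1F ∷ s ≡ []) ⊎ StartsWith 1F (f ++ 1F ∷ s)
followed-++⁺ s (inj₁ refl)       = inj₂ (s , refl)
followed-++⁺ s (inj₂ (t , refl)) = inj₂ (t ++ 1F ∷ s , refl)

followed-++⁻ : ∀ f {s} → (f ++ 1F ∷ s ≡ []) ⊎ StartsWith 1F (f ++ 1F ∷ s) →
               (f ≡ []) ⊎ StartsWith 1F f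
followed-++⁻ []       _ = inj₁ refl
followed-++⁻ (1F ∷ f) _ = inj₂ (f , refl)
followed-++⁻ (0F ∷ f) (inj₂ (_ , ()))

slide-++ : ∀ a (s t : Word) {f z} → (a ++ s ++ t ++ f) ++ z ≡ a ++ s ++ t ++ f ++ z
slide-++ a s t {f} {z} = trans (++-assoc a _ z) (cong (a ++_)
  (trans (++-assoc s _ z) (cong (s ++_) (++-assoc t f z))))

-- Moves of a path with a block `1 D 0`

-- Since D varies, such a move applies both to p 1 0 0ᵏ (D = []) and to
-- p 1 v 1 0 0 0ᵏ (D = v 1 0).
BlockMove : Word → ℕ → Word → ℕ → Set
BlockMove p k p′ k′ = ∀ {D} → Desc 0 0 D →
  Move (p ++ 1F ∷ D ++ zeros (suc k)) (p′ ++ 1F ∷ D ++ zeros (suc k′))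

blockMove-before : ∀ {x} a i f {k} → Prime x → (f ≡ []) ⊎ StartsWith 1F f →
                   BlockMove (a ++ zeros (suc i) ++ x ++ f) k (a ++ x ++ zeros (suc i) ++ f) k
blockMove-before {x} a i f pr fol _ = move a i _ pr (followed-++⁺ _ fol)
  (slide-++ a (zeros (suc i)) x) (slide-++ a x (zeros (suc i)))

∷-zeros-++ : ∀ c D k i → (c ++ 1F ∷ D ++ zeros (suc k)) ++ zeros (suc i) ≡
                         c ++ 1F ∷ D ++ zeros (suc (k + suc i))
∷-zeros-++ c D k i = begin
  (c ++ 1F ∷ D ++ zeros (suc k)) ++ zeros (suc i)
    ≡⟨ ++-assoc c _ _ ⟩
  c ++ 1F ∷ (D ++ zeros (suc k)) ++ zeros (suc i)
    ≡⟨ cong (λ t → c ++ 1F ∷ t) (++-assoc D _ _) ⟩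
  c ++ 1F ∷ D ++ zeros (suc k) ++ zeros (suc i)
    ≡⟨ cong (λ t → c ++ 1F ∷ D ++ t) (zeros-+ (suc k)) ⟨
  c ++ 1F ∷ D ++ zeros (suc (k + suc i)) ∎
  where open ≡-Reasoning

-- The subpath contains the block and reaches the end of the path, so the zeros it jumps over join
-- the trailing ones. By `prime-swap` it stays prime for every block.
blockMove-around : ∀ {D} → Desc 0 0 D → ∀ a i c {k} → Prime (c ++ 1F ∷ D ++ zeros (suc k)) →
                   BlockMove (a ++ zeros (suc i) ++ c) k (a ++ c) (k + suc i)
blockMove-around dD a i c {k} pr {D′} dD′ = move a i [] (prime-swap dD dD′ c pr) (inj₁ refl)
  (begin
    (a ++ zeros (suc i) ++ c) ++ s     ≡⟨ ++-assoc a _ s ⟩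
    a ++ (zeros (suc i) ++ c) ++ s     ≡⟨ cong (a ++_) (++-assoc (zeros (suc i)) c s) ⟩
    a ++ zeros (suc i) ++ (c ++ s)     ≡⟨ cong (λ t → a ++ zeros (suc i) ++ t) (++-identityʳ (c ++ s)) ⟨
    a ++ zeros (suc i) ++ (c ++ s) ++ [] ∎)
  (begin
    (a ++ c) ++ 1F ∷ D′ ++ zeros (suc (k + suc i)) ≡⟨ ++-assoc a c _ ⟩
    a ++ c ++ 1F ∷ D′ ++ zeros (suc (k + suc i))   ≡⟨ cong (a ++_) (∷-zeros-++ c D′ k i) ⟨
    a ++ (c ++ s) ++ zeros (suc i)                 ≡⟨ cong (λ t → a ++ (c ++ s) ++ t) (++-identityʳ (zeros (suc i))) ⟨
    a ++ (c ++ s) ++ zeros (suc i) ++ []           ∎)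
  where
  open ≡-Reasoning
  s = 1F ∷ D′ ++ zeros (suc k)

-- The word `e` drops by `h`, so from height `g < h` it would go below 0.
desc-prefix-not-below : ∀ {g h} e {f} → g < h → Desc 0 g (e ++ f) → ¬ Desc 1 h e
desc-prefix-not-below []      ()        _          nil
desc-prefix-not-below (_ ∷ e) lt        (up _ d)   (up _ q)   = desc-prefix-not-below e (s≤s lt) d q
desc-prefix-not-below (_ ∷ e) (s≤s lt) (down _ d) (down _ q) = desc-prefix-not-below e lt d q

-- After the displayed letter 1 the subpath has positive height, but a prefix `e` of a Dyck path
-- cannot bring it down to 0.
prime-not-ending-inside : ∀ c {e f} → Desc 0 0 (e ++ f) → ¬ Prime (c ++ 1F ∷ e)
prime-not-ending-inside [] {e} d (prime q) = desc-prefix-not-below e (s≤s z≤n) d q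
prime-not-ending-inside (_ ∷ c) {e} d (prime q) = go c q
  where
  go : ∀ {h} c → ¬ Desc 1 h (c ++ 1F ∷ e)
  go []      (up _ q)   = desc-prefix-not-below e (s≤s z≤n) d q
  go (_ ∷ c) (up _ q)   = go c q
  go (_ ∷ c) (down _ q) = go c q

block-move : ∀ {D} → Desc 0 0 D → ∀ p k {w′} → Move (p ++ 1F ∷ D ++ zeros (suc k)) w′ →
  (∃₂ λ p′ k′ → w′ ≡ p′ ++ 1F ∷ D ++ zeros (suc k′) × BlockMove p k p′ k′) ⊎
  (∃ λ r → w′ ≡ p ++ 1F ∷ r × Move (D ++ zeros (suc k)) r)
block-move {D} dD p k (move a i {x} b pr fol src refl)
  with split-at a p (sym src)
-- The letter 1 opening the block lies in `a`: the whole move happens after it.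
... | inj₂ (c , refl , eq) = inj₂ (_ , ++-assoc p _ _ , move c i b pr fol eq refl)
... | inj₁ (c , refl , eq)
  with split-at (zeros (suc i)) c eq
...   | inj₂ (e , eq′ , _) = contradiction eq′ (zeros-no-1 (suc i) c)
...   | inj₁ (e , refl , eq′)
  with split-at x e eq′
-- The subpath ends before the block.
...     | inj₁ (f , refl , refl) =
  inj₁ (_ , _ , sym (Move.target (before dD)) , before)
  where
  before : BlockMove (a ++ zeros (suc i) ++ x ++ f) k (a ++ x ++ zeros (suc i) ++ f) k
  before = blockMove-before a i f pr (followed-++⁻ f fol)
-- The subpath contains the opening 1 of the block; what follows it decides.
...     | inj₂ (f , refl , eq″) with fol
...       | inj₁ refl
  with refl ← trans eq″ (++-identityʳ f) =
  inj₁ (_ , _ , sym (Move.target (around dD)) , around)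
  where
  around : BlockMove (a ++ zeros (suc i) ++ e) k (a ++ e) (k + suc i)
  around = blockMove-around dD a i e pr
-- A letter 1 after the subpath is not among the trailing zeros, so it would lie in `D`, and the
-- subpath would end inside `D`.
...       | inj₂ (t , refl) with split-at D f eq″
...         | inj₁ (c , _ , eq‴) = contradiction eq‴ (zeros-no-1 (suc k) c)
...         | inj₂ (c , refl , _) = contradiction pr (prime-not-ending-inside e dD)

-- Moves after the opening letter of the block

-- From height `g`, the word `d` leads to `g - h`, which is at most 0, while height at least 1 is
-- required before the next letter 1.
desc-not-crossing : ∀ {b g h} d {s} → g ≤ h → Desc b h d → ¬ Desc 1 g (d ++ 1F ∷ s)
desc-not-crossing []      z≤n       nil        (up () _)
desc-not-crossing (_ ∷ d) le        (up _ p)   (up _ q)   = desc-not-crossing d (s≤s le) p q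
desc-not-crossing (_ ∷ d) (s≤s le) (down _ p) (down _ q) = desc-not-crossing d le p q

-- With `d` empty, the first 0 already returns to the starting height, and the second 0 goes below
-- it. Otherwise the initial 1 of `d` is matched within `d`.
prime-not-crossing : ∀ {b h k} d → Desc b h d → ¬ Prime (d ++ 1F ∷ zeros (suc (suc k)))
prime-not-crossing []      _        (prime (down _ ()))
prime-not-crossing (_ ∷ d) (up _ p) (prime q) = desc-not-crossing d (s≤s z≤n) p q

desc-10-move : ∀ {v} → Desc 0 0 v → ∀ k {w′} → Move (v ++ 1F ∷ zeros (suc (suc k))) w′ →
               ∃ λ v′ → w′ ≡ v′ ++ 1F ∷ zeros (suc (suc k)) × Move v v′
desc-10-move {v} dv k (move a i {x} b pr fol src refl)
  with split-at (a ++ zeros (suc i)) v (trans (++-assoc a _ _) (sym src))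
-- The subpath would lie within the trailing zeros.
... | inj₂ (c , _ , eq) = contradiction eq (prime-not-in-zeros pr (suc (suc k)) c)
... | inj₁ (d , refl , eq)
  with split-at x d eq
...   | inj₁ (f , refl , refl) = a ++ x ++ zeros (suc i) ++ f , sym (slide-++ a x (zeros (suc i))) ,
  move a i f pr (followed-++⁻ f fol) (++-assoc a (zeros (suc i)) _) refl
...   | inj₂ (f , refl , eq′) with fol
...     | inj₂ (t , refl) = contradiction eq′ (zeros-no-1 (suc (suc k)) f)
-- The subpath would start in `v` or at its end and run to the end of the word.
...     | inj₁ refl
  with refl ← trans eq′ (++-identityʳ f) =
  contradiction pr (prime-not-crossing d (proj₂ (desc-suffix (a ++ zeros (suc i)) dv)))

move-++ : ∀ p {v v′} s → Move v v′ → Move (p ++ v ++ 1F ∷ s) (p ++ v′ ++ 1F ∷ s)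
move-++ p s (move a i {x} b pr fol refl refl) = move (p ++ a) i _ pr (followed-++⁺ s fol)
  (trans (cong (p ++_) (slide-++ a (zeros (suc i)) x)) (sym (++-assoc p a _)))
  (trans (cong (p ++_) (slide-++ a x (zeros (suc i)))) (sym (++-assoc p a _)))

desc-∷ʳ-10 : ∀ {v} → Desc 0 0 v → Desc 0 0 (v ++ 1F ∷ 0F ∷ [])
desc-∷ʳ-10 dv = desc-insert z≤n dv (up z≤n (down z≤n nil))

-- Uniqueness of the factors

zeros-injective : ∀ {m n} → zeros m ≡ zeros n → m ≡ n
zeros-injective {m} {n} eq =
  trans (sym (length-replicate m)) (trans (cong length eq) (length-replicate n))

last-1-unique : ∀ p p′ {k k′} → p ++ 1F ∷ zeros k ≡ p′ ++ 1F ∷ zeros k′ → p ≡ p′ × k ≡ k′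
last-1-unique p p′ {k} {k′} eq with split-unique p p′ (λ c → zeros-no-1 k c) (λ c → zeros-no-1 k′ c) eq
... | p≡p′ , eq′ = p≡p′ , zeros-injective eq′

-- After a letter 1 inside `v` the height is positive, whereas a Dyck suffix `v′` must start at
-- height 0.
desc-not-after-1 : ∀ {v v′} → Desc 0 0 v → Desc 0 0 v′ → ∀ c → v ≢ c ++ 1F ∷ v′
desc-not-after-1 dv dv′ c refl with _ , up _ d ← desc-suffix c dv with () ← desc-start-unique d dv′

dyckSuffix-unique : ∀ p p′ {v v′} → Desc 0 0 v → Desc 0 0 v′ →
                    p ++ 1F ∷ v ≡ p′ ++ 1F ∷ v′ → p ≡ p′ × v ≡ v′
dyckSuffix-unique p p′ dv dv′ =
  split-unique p p′ (desc-not-after-1 dv dv′) (desc-not-after-1 dv′ dv)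

word-injective : ∀ {n} {w w′ : DyckPath n} → word w ≡ word w′ → w ≡ w′
word-injective refl = refl

-- Factor pairs and the isomorphism

-- A relation, with `p` and `k` free to change along edges. It is one-to-one, and edges can be
-- followed across it in both directions.
record Factors {n l m} (z : DyckPath n) (u : DyckPath l) (v : DyckPath m) : Set where
  constructor factors
  field
    p     : Word
    k     : ℕ
    whole : word z ≡ p ++ 1F ∷ word v ++ 1F ∷ 0F ∷ 0F ∷ zeros k
    outer : word u ≡ p ++ 1F ∷ 0F ∷ zeros k

module _ {n l m : ℕ} where

  private variable
    z z′ : DyckPath n
    u u′ : DyckPath l
    v v′ : DyckPath m

  factors-functional : Factors z u v → Factors z u′ v′ → u ≡ u′ × v ≡ v′
  factors-functional {v = v} {v′ = v′} (factors p k zeq ueq) (factors p′ k′ zeq′ ueq′)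
    with eq , refl ← last-1-unique (p ++ 1F ∷ word v) (p′ ++ 1F ∷ word v′)
           (trans (++-assoc p _ _) (trans (trans (sym zeq) zeq′) (sym (++-assoc p′ _ _))))
    with refl , eq′ ← dyckSuffix-unique p p′ (word-desc v) (word-desc v′) eq
    = word-injective (trans ueq (sym ueq′)) , word-injective eq′

  factors-injective : Factors z u v → Factors z′ u v → z ≡ z′
  factors-injective (factors p k zeq ueq) (factors p′ k′ zeq′ ueq′)
    with refl , refl ← last-1-unique p p′ (trans (sym ueq) ueq′)
    = word-injective (trans zeq (sym zeq′))

  edge-factors : Factors z u v → z ⟶ z′ →
                 ∃₂ λ (u′ : DyckPath l) (v′ : DyckPath m) → Factors z′ u′ v′ × u ≼ u′ × v ≼ v′
  edge-factors {z} {u} {v} {z′} (factors p k zeq ueq) e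
    -- The block is `1 D 0` with `D = v 1 0`.
    with block-move (desc-∷ʳ-10 (word-desc v)) p k
           (subst (λ t → Move t (word z′))
             (trans zeq (cong (λ t → p ++ 1F ∷ t) (sym (++-assoc (word v) _ _)))) (edge⇒move e))
  ... | inj₁ (p′ , k′ , eq , bm)
    -- The same block move with `D` empty is an edge from `u`.
    with u′ , ueq′ , u≼u′ ← move-from u (subst (λ t → Move t _) (sym ueq) (bm nil))
    = u′ , v , factors p′ k′ (trans eq (cong (λ t → p′ ++ 1F ∷ t) (++-assoc (word v) _ _))) ueq′
    , u≼u′ , ε
  ... | inj₂ (r , eq , inner)
    with x , refl , mv ← desc-10-move (word-desc v) k
                           (subst (λ t → Move t r) (++-assoc (word v) _ _) inner)
    with v′ , refl , v≼v′ ← move-from v mv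
    = u , v′ , factors p k eq ueq , ε , v≼v′

  outer-edge : Factors z u v → u ⟶ u′ → ∃ λ (z′ : DyckPath n) → Factors z′ u′ v × z ≼ z′
  outer-edge {z} {u} {v} {u′} (factors p k zeq ueq) e
    with block-move nil p k (subst (λ t → Move t (word u′)) ueq (edge⇒move e))
  -- With `D` empty, only zeros follow the opening 1, and these admit no move.
  ... | inj₂ (_ , _ , inner) = contradiction inner (zeros-no-move (suc k))
  ... | inj₁ (p′ , k′ , eq , bm)
    with z′ , zeq′ , z≼z′ ← move-from z (subst (λ t → Move t _)
           (sym (trans zeq (cong (λ t → p ++ 1F ∷ t) (sym (++-assoc (word v) _ _)))))
           (bm (desc-∷ʳ-10 (word-desc v))))
    = z′ , factors p′ k′ (trans zeq′ (cong (λ t → p′ ++ 1F ∷ t) (++-assoc (word v) _ _))) eq , z≼z′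

  inner-edge : Factors z u v → v ⟶ v′ → ∃ λ (z′ : DyckPath n) → Factors z′ u v′ × z ≼ z′
  inner-edge {z} {v = v} (factors p k zeq ueq) e
    with z′ , zeq′ , z≼z′ ← move-from z (subst (λ t → Move t _)
           (sym (trans zeq (sym (++-assoc p (1F ∷ []) _))))
           (move-++ (p ∷ʳ 1F) _ (edge⇒move e)))
    = z′ , factors p k (trans zeq′ (++-assoc p (1F ∷ []) _)) ueq , z≼z′

  ≼-factors : Factors z u v → z ≼ z′ →
              ∃₂ λ (u′ : DyckPath l) (v′ : DyckPath m) → Factors z′ u′ v′ × u ≼ u′ × v ≼ v′
  ≼-factors F ε = _ , _ , F , ε , ε
  ≼-factors F (e ◅ es)
    with _ , _ , F′ , u≼ , v≼ ← edge-factors F e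
    with u″ , v″ , F″ , u≼′ , v≼′ ← ≼-factors F′ es
    = u″ , v″ , F″ , u≼ ◅◅ u≼′ , v≼ ◅◅ v≼′

  -- The outer chain is followed first with `v` fixed, then the inner chain.
  factors-≼ : Factors z u v → u ≼ u′ → v ≼ v′ → ∃ λ (z′ : DyckPath n) → Factors z′ u′ v′ × z ≼ z′
  factors-≼ F ε ε = _ , F , ε
  factors-≼ F ε (e ◅ es)
    with _ , F′ , z≼ ← inner-edge F e
    with z″ , F″ , z≼′ ← factors-≼ F′ ε es
    = z″ , F″ , z≼ ◅◅ z≼′
  factors-≼ F (e ◅ es) fs
    with _ , F′ , z≼ ← outer-edge F e
    with z″ , F″ , z≼′ ← factors-≼ F′ es fs
    = z″ , F″ , z≼ ◅◅ z≼′

  Up-factors : Factors z u v → Up z ≅ ×-poset (Up u) (Up v)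
  Up-factors {z} {u} {v} F = f , record
    { isOrderMonomorphism = record
      { isOrderHomomorphism = record
        -- Equal elements may carry different chains, and `f` is computed from the chain; uniqueness
        -- of the factors makes the results agree.
        { cong = λ { {x} {y} refl → factors-functional (f-factors x) (f-factors y) }
        ; mono = λ {x} {y} → mono {x} {y}
        }
      ; injective = λ {x} {y} (p , q) →
          factors-injective (subst₂ (Factors (proj₁ x)) p q (f-factors x)) (f-factors y)
      ; cancel    = λ {x} {y} → cancel {x} {y}
      }
    ; surjective = surjective
    }
    where
    module P = Poset (Up z)
    module Q = Poset (×-poset (Up u) (Up v))

    f : P.Carrier → Q.Carrier
    f (_ , z≼) with u′ , v′ , _ , u≼ , v≼ ← ≼-factors F z≼ = (u′ , u≼) , (v′ , v≼)

    f-factors : ∀ x → Factors (proj₁ x) (proj₁ (proj₁ (f x))) (proj₁ (proj₂ (f x)))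
    f-factors (_ , z≼) = proj₁ (proj₂ (proj₂ (≼-factors F z≼)))

    mono : ∀ {x y} → x P.≤ y → f x Q.≤ f y
    mono {x} {y} x≤y
      with _ , _ , F′ , u≼ , v≼ ← ≼-factors (f-factors x) x≤y
      -- The factors reached from those of `x` are the ones `f` assigns to `y`.
      with refl , refl ← factors-functional F′ (f-factors y)
      = u≼ , v≼

    cancel : ∀ {x y} → f x Q.≤ f y → x P.≤ y
    cancel {x} {y} (u≼ , v≼)
      with _ , F′ , z≼ ← factors-≼ (f-factors x) u≼ v≼
      with refl ← factors-injective F′ (f-factors y)
      = z≼

    surjective : ∀ y → ∃ λ x → ∀ {x′} → x′ P.≈ x → f x′ Q.≈ y
    surjective ((u′ , u≼) , (v′ , v≼))
      with z′ , F′ , z≼ ← factors-≼ F u≼ v≼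
      = (z′ , z≼) , λ { {x′} refl → factors-functional (f-factors x′) F′ }

proposition4p8 : ∀ {n m : ℕ} (w : DyckPath n) (u : Word) (v : DyckPath m) (k : ℕ) →
    word w ≡ u ++ 1F ∷ word v ++ 1F ∷ 0F ∷ 0F ∷ replicate k 0F →
    ∃₂ λ (l : ℕ) (u′ : DyckPath l) →
    (word u′ ≡ u ++ 1F ∷ 0F ∷ replicate k 0F) × (Up w ≅ ×-poset (Up u′) (Up v))
proposition4p8 w u v k eq =
  -- The size `l` is the number of letters 1, read off from `refl`.
  _ , dyck (u ++ 1F ∷ 0F ∷ zeros k) (desc⇒isDyck refl outer-desc) , refl ,
  Up-factors (factors u k eq refl)
  where
  outer-desc : Desc 0 0 (u ++ 1F ∷ 0F ∷ zeros k)
  -- The path `u′` arises from `w` by replacing `D = v 1 0` with the empty path.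
  outer-desc = desc-swap (desc-∷ʳ-10 (word-desc v)) nil u
    (subst (Desc 0 0) (trans eq (cong (λ t → u ++ 1F ∷ t) (sym (++-assoc (word v) _ _)))) (word-desc w))
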